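{- Let $G$ be a graph, $B$ a PSD forcing set of $G$, $\mathcal F$ a relaxed chronology of PSD forces of $B$ on $G$, $x\in V(G)$, and $\mathcal Q$ the path bundle of $\mathcal F$ induced by $x$. Then $\mathcal Q$ is a rigid linkage of $G$.
   Context: All graphs are finite, simple and undirected. Each vertex is blue or white. PSD rule: if $B$ is the current set of blue vertices, $C$ is a component of $G-B$, and $u\in B$ satisfies $N_G(u)\cap V(C)=\{v\}$, then $u$ can force $v$ to become blue ($u\to v$). $B$ is a PSD forcing set if, starting with exactly $B$ blue, repeated forcing turns all vertices blue. $S_+(G,B)$ is the set of PSD forces $v\to u$ valid when exactly $B$ is blue. Relaxed chronology of PSD forces for a PSD forcing set $B$ on $G$: an ordered family $\mathcal F=\{F^{(k)}\}_{k=1}^K$ of sets of forces ($F^{(k)}=\emptyset$ allowed) such that, with $E_{\mathcal F}^{[0]}=E_{\mathcal F}^{(0)}=B$, $E_{\mathcal F}^{(k)}=\{u: v\to u\in F^{(k)}\text{ for some }v\}$, $E_{\mathcal F}^{[k]}=\bigcup_{j=0}^kE_{\mathcal F}^{(j)}$: (1) $F^{(k)}\subseteq S_+(G,E_{\mathcal F}^{[k-1]})$ for all $k$; (2) $v_1\to u,v_2\to u\in F^{(k)}$ implies $v_1=v_2$; (3) $E_{\mathcal F}^{[K]}=V(G)$. For $x\in V(G)$, $\operatorname{rd}(x)$ is the unique $k$ with $x\in E_{\mathcal F}^{(k)}$. Path bundle of $\mathcal F$ induced by $x$: for $0\le k\le\operatorname{rd}(x)-1$ let $C_x^k$ be the component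 of $G-E_{\mathcal F}^{[k]}$ containing $x$. Let $B=\{v_i^0\}_{i=1}^{|B|}$ and let $Q_i^{[0]}$ be the one-vertex path on $v_i^0$. For each $i$, if $v_i^k\to w\in F^{(k+1)}$ for some $w\in V(C_x^k)$, put $v_i^{k+1}=w$ and obtain $Q_i^{[k+1]}$ by appending $w$ to the end of $Q_i^{[k]}$; otherwise put $v_i^{k+1}=v_i^k$ and $Q_i^{[k+1]}=Q_i^{[k]}$. The induced path bundle is $\mathcal Q=\{Q_i^{[\operatorname{rd}(x)]}\}_{i=1}^{|B|}$, viewed also as the subgraph of $G$ that is the disjoint union of these paths. Rigid linkages: a linkage in $G$ is a subgraph of $G$ whose connected components are paths (single vertices allowed; it need not contain all vertices of $G$). For $\alpha,\beta\subseteq V(G)$, a linkage is an $(\alpha,\beta)$-linkage if $\alpha$ consists of one endpoint of each of its paths and $\beta$ consists of the other endpoint of each path (for a one-vertex path, the vertex is in both $\alpha$ and $\beta$). A linkage $\mathcal P$ is rigid if there exist $\alpha,\beta$ such that $\mathcal P$ is an $(\alpha,\beta)$-linkage and is the unique $(\alpha,\beta)$-linkage in $G$. -}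

module Defs where

open import Data.Fin using (Fin)
open import Data.Fin.Properties using (_≟_; any?)
open import Data.Fin.Subset using (Subset; _∈_; _∉_; _⊆_; _∪_; _∩_; ∁; ⊤; ⁅_⁆; ∣_∣)
open import Data.Fin.Subset.Properties
  using (_∈?_; ∈⊤; x∈p∪q⁻; x∈p∪q⁺; x∈⁅x⁆; x∈p∩q⁻; x∈∁p⇒x∉p)
open import Data.List using (List; []; _∷_; [_]; _++_; _∷ʳ_; head; last; allFin)
import Data.List.Membership.Propositional as List
open import Data.List.Membership.Propositional.Properties using (∈-allFin)
open import Data.List.Relation.Unary.Any using (here; there)
open import Data.List.Relation.Unary.Unique.Propositional using (Unique)
open import Data.Maybe using (Maybe; just; nothing; maybe′)
open import Data.Nat using (ℕ; zero; suc; _≤_; _<_; z≤n; s≤s)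
open import Data.Nat.Properties using (≤-refl; m≤n⇒m≤1+n; m≤n⇒m<n∨m≡n; <-cmp)
open import Data.Product using (∃-syntax; _×_; _,_; proj₁; proj₂)
open import Data.Sum using (_⊎_; inj₁; inj₂)
import Data.Vec as Vec
open import Data.Vec.Properties using (lookup∘tabulate; []=⇒lookup; lookup⇒[]=)
open import Function using (_∘_; id; _⇔_; mk⇔; Injective; module Equivalence)
open import Level using (0ℓ)
open import Relation.Binary using (Rel; Decidable; Symmetric; Irreflexive; tri<; tri≈; tri>)
open import Relation.Binary.Construct.Closure.ReflexiveTransitive using (Star; ε; _◅_; _◅◅_)
open import Relation.Binary.PropositionalEquality
  using (_≡_; refl; sym; trans; subst)
open import Relation.Nullary
  using (yes; no; does; contradiction; _×-dec_; _⊎-dec_)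
open import Relation.Nullary.Decidable using (map′; dec-true)
import Relation.Unary as U

private variable
  n : ℕ

comprehension : {P : U.Pred (Fin n) 0ℓ} → U.Decidable P → Subset n
comprehension P? = Vec.tabulate (does ∘ P?)

∈-comprehension : {P : U.Pred (Fin n) 0ℓ} (P? : U.Decidable P) →
                  ∀ {x} → x ∈ comprehension P? ⇔ P x
∈-comprehension {P = P} P? {x} = mk⇔ to from
  where
  to : x ∈ comprehension P? → P x
  to x∈ with P? x | trans (sym (lookup∘tabulate (does ∘ P?) x)) ([]=⇒lookup x∈)
  ... | yes px | _ = px

  from : P x → x ∈ comprehension P?
  from px = lookup⇒[]= x _ (trans (lookup∘tabulate (does ∘ P?) x) (dec-true (P? x) px))

-- Warshall's algorithm.
module _ {R : Rel (Fin n) 0ℓ} (R? : Decidable R) where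

  private
    -- Reachability with all intermediate vertices taken from the list.
    Via : List (Fin n) → Rel (Fin n) 0ℓ
    Via []       x y = x ≡ y ⊎ R x y
    Via (k ∷ ks) x y = Via ks x y ⊎ (Via ks x k × Via ks k y)

    via? : ∀ ks → Decidable (Via ks)
    via? []       x y = (x ≟ y) ⊎-dec R? x y
    via? (k ∷ ks) x y = via? ks x y ⊎-dec (via? ks x k ×-dec via? ks k y)

    via-base : ∀ ks {x y} → x ≡ y ⊎ R x y → Via ks x y
    via-base []       p = p
    via-base (k ∷ ks) p = inj₁ (via-base ks p)

    via-trans : ∀ {ks x y z} → y List.∈ ks → Via ks x y → Via ks y z → Via ks x z
    via-trans (here refl) (inj₁ p)       (inj₁ q)       = inj₂ (p , q)
    via-trans (here refl) (inj₁ p)       (inj₂ (_ , q)) = inj₂ (p , q)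
    via-trans (here refl) (inj₂ (p , _)) (inj₁ q)       = inj₂ (p , q)
    via-trans (here refl) (inj₂ (p , _)) (inj₂ (_ , q)) = inj₂ (p , q)
    via-trans (there y∈)  (inj₁ p)       (inj₁ q)       = inj₁ (via-trans y∈ p q)
    via-trans (there y∈)  (inj₁ p)       (inj₂ (q , r)) = inj₂ (via-trans y∈ p q , r)
    via-trans (there y∈)  (inj₂ (p , q)) (inj₁ r)       = inj₂ (p , via-trans y∈ q r)
    via-trans (there y∈)  (inj₂ (p , _)) (inj₂ (_ , s)) = inj₂ (p , s)

    via⇒star : ∀ ks {x y} → Via ks x y → Star R x y
    via⇒star []       (inj₁ refl)    = ε
    via⇒star []       (inj₂ r)       = r ◅ ε
    via⇒star (k ∷ ks) (inj₁ p)       = via⇒star ks p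
    via⇒star (k ∷ ks) (inj₂ (p , q)) = via⇒star ks p ◅◅ via⇒star ks q

    star⇒via : ∀ {x y} → Star R x y → Via (allFin n) x y
    star⇒via ε       = via-base (allFin n) (inj₁ refl)
    star⇒via (r ◅ s) = via-trans (∈-allFin _) (via-base (allFin n) (inj₂ r)) (star⇒via s)

  star? : Decidable (Star R)
  star? x y = map′ (via⇒star (allFin n)) star⇒via (via? (allFin n) x y)

record Graph (n : ℕ) : Set₁ where
  field
    Adj    : Rel (Fin n) 0ℓ
    adj?   : Decidable Adj
    symm   : Symmetric Adj
    irrefl : Irreflexive _≡_ Adj

  neighbours : Fin n → Subset n
  neighbours v = comprehension (adj? v)

record Subgraph (G : Graph n) : Set₁ where
  open Graph G
  field
    vertices   : Subset n
    Edge       : Rel (Fin n) 0ℓ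
    edge?      : Decidable Edge
    edge-sym   : Symmetric Edge
    edge⇒adj   : ∀ {a b} → Edge a b → Adj a b
    edge-start : ∀ {a b} → Edge a b → a ∈ vertices

  component : Fin n → Subset n
  component x = comprehension (star? edge? x)

  IsComponent : Subset n → Set
  IsComponent C = ∃[ x ] x ∈ vertices × C ≡ component x

open Subgraph public

_≈_ : {G : Graph n} → Subgraph G → Subgraph G → Set
P ≈ P′ = vertices P ≡ vertices P′ × (∀ a b → Edge P a b ⇔ Edge P′ a b)

_-_ : (G : Graph n) → Subset n → Subgraph G
G - B = record
  { vertices   = ∁ B
  ; Edge       = λ a b → Adj a b × a ∈ ∁ B × b ∈ ∁ B
  ; edge?      = λ a b → adj? a b ×-dec (a ∈? ∁ B) ×-dec (b ∈? ∁ B)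
  ; edge-sym   = λ (ab , a∈ , b∈) → symm ab , b∈ , a∈
  ; edge⇒adj   = proj₁
  ; edge-start = proj₁ ∘ proj₂
  }
  where open Graph G

-- u → v belongs to S₊(G, B).
PSDForce : Graph n → Subset n → Fin n → Fin n → Set
PSDForce G B u v =
  u ∈ B × (∃[ C ] IsComponent (G - B) C × Graph.neighbours G u ∩ C ≡ ⁅ v ⁆)

PSDStep : Graph n → Rel (Subset n) 0ℓ
PSDStep G B B′ = ∃[ u ] ∃[ v ] PSDForce G B u v × B′ ≡ B ∪ ⁅ v ⁆

IsPSDForcingSet : Graph n → Subset n → Set
IsPSDForcingSet G B = Star (PSDStep G) B ⊤

-- A set F of forces is given by the targets of each vertex: v → u is in F
-- when u ∈ F v.
ForceSet : ℕ → Set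
ForceSet n = Fin n → Subset n

module _ (B : Subset n) (F : ℕ → ForceSet n) where

  -- E⟨ k ⟩ is the set of vertices turned blue exactly at time k (F 0 is not
  -- used), and E[ k ] is the set of vertices blue after time k.
  E⟨_⟩ : ℕ → Subset n
  E⟨ zero  ⟩ = B
  E⟨ suc k ⟩ = comprehension (λ u → any? (λ v → u ∈? F (suc k) v))

  E[_] : ℕ → Subset n
  E[ zero  ] = E⟨ zero ⟩
  E[ suc k ] = E[ k ] ∪ E⟨ suc k ⟩

-- Only the entries F 1, …, F K of F matter.
record RelaxedChronology (G : Graph n) (B : Subset n) : Set where
  field
    K        : ℕ
    F        : ℕ → ForceSet n
    valid    : ∀ {k} → k < K → ∀ {v u} → u ∈ F (suc k) v → PSDForce G (E[_] B F k) v u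
    unique   : ∀ {k} → k < K → ∀ {v₁ v₂ u} → u ∈ F (suc k) v₁ → u ∈ F (suc k) v₂ → v₁ ≡ v₂
    complete : E[_] B F K ≡ ⊤

  blueAt blueBy : ℕ → Subset n
  blueAt = E⟨_⟩ B F
  blueBy = E[_] B F

  blueBy⇒blueAt : ∀ k {x} → x ∈ blueBy k → ∃[ j ] j ≤ k × x ∈ blueAt j
  blueBy⇒blueAt zero    x∈ = zero , z≤n , x∈
  blueBy⇒blueAt (suc k) x∈ with x∈p∪q⁻ (blueBy k) (blueAt (suc k)) x∈
  ... | inj₂ x∈At = suc k , ≤-refl , x∈At
  ... | inj₁ x∈By = let j , j≤k , x∈At = blueBy⇒blueAt k x∈By in j , m≤n⇒m≤1+n j≤k , x∈At

  round : ∀ x → ∃[ k ] k ≤ K × x ∈ blueAt k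
  round x = blueBy⇒blueAt K (subst (x ∈_) (sym complete) ∈⊤)

  rd : Fin n → ℕ
  rd x = proj₁ (round x)

  rd≤K : ∀ x → rd x ≤ K
  rd≤K x = proj₁ (proj₂ (round x))

  rd-blueAt : ∀ x → x ∈ blueAt (rd x)
  rd-blueAt x = proj₂ (proj₂ (round x))

  private
    blueAt⇒blueBy : ∀ {j} k → j ≤ k → ∀ {x} → x ∈ blueAt j → x ∈ blueBy k
    blueAt⇒blueBy zero    z≤n x∈ = x∈
    blueAt⇒blueBy (suc k) j≤  x∈ with m≤n⇒m<n∨m≡n j≤
    ... | inj₁ (s≤s j≤k) = x∈p∪q⁺ (inj₁ (blueAt⇒blueBy k j≤k x∈))
    ... | inj₂ refl      = x∈p∪q⁺ {p = blueBy k} (inj₂ x∈)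

    star-end : ∀ {S a b} → Star (Edge (G - S)) a b → a ∈ ∁ S → b ∈ ∁ S
    star-end ε                   a∈ = a∈
    star-end ((_ , _ , c∈) ◅ cs) _  = star-end cs c∈

    not-earlier : ∀ {j k x} → j < k → k ≤ K → x ∈ blueAt j → x ∉ blueAt k
    not-earlier {k = suc k} {x} (s≤s j≤k) k<K x∈j x∈k
      with v , x∈F ← Equivalence.to (∈-comprehension (λ u → any? (λ v → u ∈? F (suc k) v))) x∈k
      with _ , C , (c , c∈ , refl) , eq ← valid k<K x∈F
      with _ , x∈C ← x∈p∩q⁻ _ C (subst (x ∈_) (sym eq) (x∈⁅x⁆ x))
      = x∈∁p⇒x∉p
          (star-end (Equivalence.to (∈-comprehension (star? (edge? (G - blueBy k)) c)) x∈C) c∈)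
          (blueAt⇒blueBy k j≤k x∈j)

  rd-unique : ∀ {x k} → k ≤ K → x ∈ blueAt k → k ≡ rd x
  rd-unique {x} {k} k≤K x∈ with <-cmp k (rd x)
  ... | tri< k<r _ _ = contradiction (rd-blueAt x) (not-earlier k<r (rd≤K x) x∈)
  ... | tri≈ _ k≡r _ = k≡r
  ... | tri> _ _ r<k = contradiction x∈ (not-earlier r<k k≤K (rd-blueAt x))

record Enumeration (B : Subset n) : Set where
  field
    vertex     : Fin ∣ B ∣ → Fin n
    injective  : Injective _≡_ _≡_ vertex
    sound      : ∀ i → vertex i ∈ B
    exhaustive : ∀ {b} → b ∈ B → ∃[ i ] vertex i ≡ b

module _ {G : Graph n} {B : Subset n} (𝓕 : RelaxedChronology G B)
         (e : Enumeration B) (x : Fin n) where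
  open RelaxedChronology 𝓕

  -- Cₓ k is the component of G - E[ k ] containing x, provided k < rd x.
  Cₓ : ℕ → Subset n
  Cₓ k = component (G - blueBy k) x

  -- The w ∈ Cₓ k with u → w in F (suc k), if there is one; for k < rd x there is
  -- at most one, as u has a single neighbour in Cₓ k whenever u → w is valid.
  next : ℕ → Fin n → Maybe (Fin n)
  next k u with any? (λ w → (w ∈? F (suc k) u) ×-dec (w ∈? Cₓ k))
  ... | yes (w , _) = just w
  ... | no  _       = nothing

  terminal : ℕ → Fin ∣ B ∣ → Fin n
  terminal zero    i = Enumeration.vertex e i
  terminal (suc k) i = maybe′ id (terminal k i) (next k (terminal k i))

  bundlePath : ℕ → Fin ∣ B ∣ → List (Fin n)
  bundlePath zero    i = [ Enumeration.vertex e i ]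
  bundlePath (suc k) i =
    maybe′ (λ w → bundlePath k i ∷ʳ w) (bundlePath k i) (next k (terminal k i))

  pathBundle : Fin ∣ B ∣ → List (Fin n)
  pathBundle = bundlePath (rd x)

Consecutive : List (Fin n) → Rel (Fin n) 0ℓ
Consecutive p a b = ∃[ xs ] ∃[ ys ] p ≡ xs ++ a ∷ b ∷ ys

PathEdge : List (Fin n) → Rel (Fin n) 0ℓ
PathEdge p a b = Consecutive p a b ⊎ Consecutive p b a

module _ {G : Graph n} where

  record IsDisjointUnionOfPaths {m} (P : Subgraph G) (Q : Fin m → List (Fin n)) : Set where
    field
      simple       : ∀ i → Unique (Q i)
      disjoint     : ∀ {i j v} → v List.∈ Q i → v List.∈ Q j → i ≡ j
      hasVertices  : ∀ v → v ∈ vertices P ⇔ (∃[ i ] v List.∈ Q i)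
      hasEdges     : ∀ a b → Edge P a b ⇔ (∃[ i ] PathEdge (Q i) a b)

  -- The part of P on C is the path with vertex sequence p.
  record IsPathOn (P : Subgraph G) (C : Subset n) (p : List (Fin n)) : Set where
    field
      simple      : Unique p
      hasVertices : ∀ v → v ∈ C ⇔ v List.∈ p
      hasEdges    : ∀ {a b} → a ∈ C → b ∈ C → Edge P a b ⇔ PathEdge p a b

  IsLinkage : Subgraph G → Set
  IsLinkage P = ∀ {C} → IsComponent P C → ∃[ p ] IsPathOn P C p

  MeetsAtEnds : (α β C : Subset n) → List (Fin n) → Set
  MeetsAtEnds α β C p =
    ∃[ a ] ∃[ b ] head p ≡ just a × last p ≡ just b × α ∩ C ≡ ⁅ a ⁆ × β ∩ C ≡ ⁅ b ⁆

  record IsLinkageBetween (α β : Subset n) (P : Subgraph G) : Set where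
    field
      linkage : IsLinkage P
      α⊆      : α ⊆ vertices P
      β⊆      : β ⊆ vertices P
      -- p runs from the end in α to the end in β, so the path of C may have to
      -- be traversed in the reverse of the order supplied by linkage.
      ends    : ∀ {C} → IsComponent P C → ∃[ p ] IsPathOn P C p × MeetsAtEnds α β C p

  IsRigidLinkage : Subgraph G → Set₁
  IsRigidLinkage P =
    ∃[ α ] ∃[ β ] IsLinkageBetween α β P × (∀ P′ → IsLinkageBetween α β P′ → P′ ≈ P)

{-# OPTIONS --safe #-}
module Submission where

-- Let T k be the set of ends of the paths after round k and C k the component of x
-- in G - E[ k ].  All blue neighbours of C k lie in T k.  Now take any linkage from B
-- to T (rd x).  Every one of its paths starts with the k-th stage of the bundle path
-- from the same vertex of B, and the rest of it avoids E[ k ]: by induction on k, the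
-- rest is connected and ends in T (rd x) outside E[ k ], hence lies in C k.  So a path
-- whose bundle path is extended in round k + 1 can continue only to the forced vertex,
-- the sole neighbour in C k, and it must continue, as its present end is not in
-- T (rd x).  Finally, the vertices of C k forced in round k + 1 are all forced by
-- vertices of T k, so they are used up by the extended initial segments.  For k = rd x
-- nothing is left after the initial segment, as the linkage ends in T (rd x).

open import Defs
open import Data.Nat using (ℕ; zero; suc; _≤_; _<_; _≤′_; ≤′-refl; ≤′-step)
open import Data.Nat.Properties
  using (≤-refl; ≤-trans; <⇒≤; <-≤-trans; ≤-<-trans; <-irrefl; ≤⇒≤′)
open import Data.Fin using (Fin)
open import Data.Fin.Properties using (_≟_; any?)
open import Data.Fin.Subset using (Subset; _∈_; _∉_; _∩_; ∁; ⁅_⁆; ∣_∣)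
open import Data.Fin.Subset.Properties
  using (_∈?_; ⊆-antisym; x∈p∪q⁻; x∈p∪q⁺; x∈⁅x⁆; x∈⁅y⁆⇒x≡y; x∈p∩q⁻; x∈p∩q⁺; x∈∁p⇒x∉p; x∉p⇒x∈∁p)
open import Data.List using (List; []; _∷_; _++_; _∷ʳ_; head; last)
import Data.List.Membership.Propositional as List
open import Data.List.Membership.Propositional.Properties using (∈-++⁺ˡ; ∈-++⁺ʳ; ∈-++⁻)
open import Data.List.Properties using (∷-injective; ++-identityʳ; ∷ʳ-++)
import Data.List.Relation.Unary.All as All
open import Data.List.Relation.Unary.AllPairs using ([]; _∷_)
open import Data.List.Relation.Unary.Any as Any using (here; there)
open import Data.List.Relation.Unary.Linked as Linked using (Linked; []; [-]; _∷_)
import Data.List.Relation.Unary.Linked.Properties as Linked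
open import Data.List.Relation.Unary.Unique.Propositional using (Unique)
import Data.List.Relation.Unary.Unique.Propositional.Properties as Unique
open import Data.Maybe using (just; nothing; maybe′)
open import Data.Maybe.Properties using (just-injective)
open import Data.Maybe.Relation.Binary.Connected using (Connected; just)
open import Data.Product using (Σ-syntax; ∃-syntax; _×_; _,_; proj₁; proj₂)
open import Data.Sum as Sum using (_⊎_; inj₁; inj₂)
open import Function using (_∘_; id; _⇔_; mk⇔; module Equivalence)
open Equivalence using (to; from)
open import Level using (0ℓ)
open import Relation.Binary using (Rel; Decidable)
open import Relation.Binary.Construct.Closure.ReflexiveTransitive as Star
  using (Star; ε; _◅_; _◅◅_)
open import Relation.Binary.PropositionalEquality
  using (_≡_; refl; sym; trans; cong; subst)
open import Relation.Nullary using (¬_; yes; no; contradiction; _×-dec_; _⊎-dec_)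
open import Relation.Nullary.Decidable using (map′)
import Relation.Unary as U

private variable
  n : ℕ

-- Lists

module _ {A : Set} where

  last-++-∷ : ∀ (xs : List A) y ys → last (xs ++ y ∷ ys) ≡ last (y ∷ ys)
  last-++-∷ []            y ys = refl
  last-++-∷ (_ ∷ [])      y ys = refl
  last-++-∷ (_ ∷ x ∷ xs)  y ys = last-++-∷ (x ∷ xs) y ys

  last-∷ : ∀ y (ys : List A) → ∃[ b ] last (y ∷ ys) ≡ just b × b List.∈ y ∷ ys
  last-∷ y []       = y , refl , here refl
  last-∷ y (z ∷ zs) = let b , eq , b∈ = last-∷ z zs in b , eq , there b∈

  Unique-++⇒disjoint : ∀ xs {ys : List A} {z} → Unique (xs ++ ys) → z List.∈ xs → ¬ z List.∈ ys
  Unique-++⇒disjoint (x ∷ xs) (x∉ ∷ _) (here refl) z∈ys = All.lookup x∉ (∈-++⁺ʳ xs z∈ys) refl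
  Unique-++⇒disjoint (x ∷ xs) (_ ∷ u)  (there z∈)  z∈ys = Unique-++⇒disjoint xs u z∈ z∈ys

  linked⇒star : ∀ {R : Rel A 0ℓ} {y ys z} → Linked R (y ∷ ys) → z List.∈ y ∷ ys → Star R y z
  linked⇒star _        (here refl) = ε
  linked⇒star (r ∷ rs) (there z∈)  = r ◅ linked⇒star rs z∈

consecutive-there : ∀ {p} {a b c : Fin n} → Consecutive p a b → Consecutive (c ∷ p) a b
consecutive-there {c = c} (xs , ys , refl) = c ∷ xs , ys , refl

consecutive⇒∈ : ∀ {p} {a b : Fin n} → Consecutive p a b → a List.∈ p × b List.∈ p
consecutive⇒∈ (xs , _ , refl) = ∈-++⁺ʳ xs (here refl) , ∈-++⁺ʳ xs (there (here refl))

pathEdge⇒∈ : ∀ {p} {a b : Fin n} → PathEdge p a b → a List.∈ p × b List.∈ p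
pathEdge⇒∈ (inj₁ ab) = consecutive⇒∈ ab
pathEdge⇒∈ (inj₂ ba) = let b∈ , a∈ = consecutive⇒∈ ba in a∈ , b∈

consecutive? : ∀ (p : List (Fin n)) → Decidable (Consecutive p)
consecutive? []          a b = no λ { ([] , _ , ()) ; (_ ∷ _ , _ , ()) }
consecutive? (_ ∷ [])    a b = no λ { ([] , _ , ()) ; (_ ∷ [] , _ , ()) ; (_ ∷ _ ∷ _ , _ , ()) }
consecutive? (c ∷ d ∷ p) a b =
  map′ join split (((c ≟ a) ×-dec (d ≟ b)) ⊎-dec consecutive? (d ∷ p) a b)
  where
  join : (c ≡ a × d ≡ b) ⊎ Consecutive (d ∷ p) a b → Consecutive (c ∷ d ∷ p) a b
  join (inj₁ (refl , refl)) = [] , p , refl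
  join (inj₂ ab)            = consecutive-there ab

  split : Consecutive (c ∷ d ∷ p) a b → (c ≡ a × d ≡ b) ⊎ Consecutive (d ∷ p) a b
  split ([]     , _  , refl) = inj₁ (refl , refl)
  split (_ ∷ xs , ys , eq)   = inj₂ (xs , ys , proj₂ (∷-injective eq))

pathEdge? : ∀ (p : List (Fin n)) → Decidable (PathEdge p)
pathEdge? p a b = consecutive? p a b ⊎-dec consecutive? p b a

module _ {R : Rel (Fin n) 0ℓ} where

  linked-++⁻ʳ : ∀ xs {ys} → Linked R (xs ++ ys) → Linked R ys
  linked-++⁻ʳ []       rs = rs
  linked-++⁻ʳ (_ ∷ xs) rs = linked-++⁻ʳ xs (Linked.tail rs)

  linked⇒consecutive : ∀ {p a b} → Linked R p → Consecutive p a b → R a b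
  linked⇒consecutive rs (xs , _ , refl) = Linked.head (linked-++⁻ʳ xs rs)

  consecutive⇒linked : ∀ {p} → (∀ {a b} → Consecutive p a b → R a b) → Linked R p
  consecutive⇒linked {[]}        _ = []
  consecutive⇒linked {_ ∷ []}    _ = [-]
  consecutive⇒linked {_ ∷ _ ∷ p} f = f ([] , p , refl) ∷ consecutive⇒linked (f ∘ consecutive-there)

-- Components

∩≡⁅⁆ : ∀ {S T : Subset n} {a} → a ∈ S → a ∈ T → (∀ {b} → b ∈ S → b ∈ T → b ≡ a) → S ∩ T ≡ ⁅ a ⁆
∩≡⁅⁆ {S = S} {T} {a} a∈S a∈T only = ⊆-antisym
  (λ b∈ → let b∈S , b∈T = x∈p∩q⁻ S T b∈ in subst (_∈ ⁅ a ⁆) (sym (only b∈S b∈T)) (x∈⁅x⁆ a))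
  (λ b∈ → subst (_∈ S ∩ T) (sym (x∈⁅y⁆⇒x≡y a b∈)) (x∈p∩q⁺ (a∈S , a∈T)))

∩≡⁅⁆⁻ : ∀ {S T : Subset n} {a b} → S ∩ T ≡ ⁅ a ⁆ → b ∈ S → b ∈ T → b ≡ a
∩≡⁅⁆⁻ {a = a} {b} eq b∈S b∈T = x∈⁅y⁆⇒x≡y a (subst (b ∈_) eq (x∈p∩q⁺ (b∈S , b∈T)))

module _ {G : Graph n} (P : Subgraph G) where

  ∈-component : ∀ {v w} → w ∈ component P v ⇔ Star (Edge P) v w
  ∈-component {v} = ∈-comprehension (star? (edge? P) v)

  component-refl : ∀ v → v ∈ component P v
  component-refl _ = from ∈-component ε

  component-sym : ∀ {v w} → w ∈ component P v → v ∈ component P w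
  component-sym = from ∈-component ∘ Star.reverse (edge-sym P) ∘ to ∈-component

  component-trans : ∀ {u v w} → v ∈ component P u → w ∈ component P v → w ∈ component P u
  component-trans v∈ w∈ = from ∈-component (to ∈-component v∈ ◅◅ to ∈-component w∈)

  component-edge : ∀ {u v w} → v ∈ component P u → Edge P v w → w ∈ component P u
  component-edge v∈ vw = component-trans v∈ (from ∈-component (vw ◅ ε))

  component⊆vertices : ∀ {v w} → v ∈ vertices P → w ∈ component P v → w ∈ vertices P
  component⊆vertices v∈ w∈ = go v∈ (to ∈-component w∈)
    where
    go : ∀ {a b} → a ∈ vertices P → Star (Edge P) a b → b ∈ vertices P
    go a∈ ε          = a∈
    go _  (ab ◅ rest) = go (edge-start P (edge-sym P ab)) rest

-- Disjoint unions of paths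

onSome? : ∀ {m} (Q : Fin m → List (Fin n)) → U.Decidable (λ v → ∃[ i ] v List.∈ Q i)
onSome? Q v = any? λ i → Any.any? (v ≟_) (Q i)

module _ {G : Graph n} {m} (Q : Fin m → List (Fin n)) where
  open Graph G

  unionOfPaths : (∀ i → Linked Adj (Q i)) → Subgraph G
  unionOfPaths linked = record
    { vertices   = comprehension (onSome? Q)
    ; Edge       = λ a b → ∃[ i ] PathEdge (Q i) a b
    ; edge?      = λ a b → any? λ i → pathEdge? (Q i) a b
    ; edge-sym   = λ (i , ab) → i , Sum.swap ab
    ; edge⇒adj   = λ where
        (i , inj₁ ab) → linked⇒consecutive (linked i) ab
        (i , inj₂ ba) → symm (linked⇒consecutive (linked i) ba)
    ; edge-start = λ (i , ab) → from (∈-comprehension (onSome? Q)) (i , proj₁ (pathEdge⇒∈ ab))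
    }

module _ {G : Graph n} {m} {P : Subgraph G} {Q : Fin m → List (Fin n)}
         (isUnion : IsDisjointUnionOfPaths P Q) where
  open IsDisjointUnionOfPaths isUnion

  component-path⁺ : ∀ {i v w} → v List.∈ Q i → w List.∈ Q i → w ∈ component P v
  component-path⁺ {i} v∈ w∈ with Q i in eq
  ... | y ∷ ys = component-trans P (component-sym P (reach v∈)) (reach w∈)
    where
    reach : ∀ {z} → z List.∈ y ∷ ys → z ∈ component P y
    reach = from (∈-component P) ∘ linked⇒star (consecutive⇒linked λ {a} {b} ab →
      from (hasEdges _ _) (i , inj₁ (subst (λ p → Consecutive p a b) (sym eq) ab)))

  -- A walk in `P` never leaves `Q i`: each edge lies on some `Q j`, and sharing a vertex with `Q i`
  -- makes `Q j` equal to it.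
  component-path⁻ : ∀ {i v w} → v List.∈ Q i → w ∈ component P v → w List.∈ Q i
  component-path⁻ {i} v∈ w∈ = go v∈ (to (∈-component P) w∈)
    where
    go : ∀ {a b} → a List.∈ Q i → Star (Edge P) a b → b List.∈ Q i
    go a∈ ε           = a∈
    go a∈ (ac ◅ rest) with to (hasEdges _ _) ac
    ... | j , e with disjoint a∈ (proj₁ (pathEdge⇒∈ e))
    ... | refl = go (proj₂ (pathEdge⇒∈ e)) rest

  component-isPathOn : ∀ {i v} → v List.∈ Q i → IsPathOn P (component P v) (Q i)
  component-isPathOn {i} {v} v∈ = record
    { simple      = simple i
    ; hasVertices = λ w → mk⇔ (component-path⁻ v∈) (component-path⁺ v∈)
    ; hasEdges    = λ {a} {b} a∈ b∈ → mk⇔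
        (λ ab → let j , e = to (hasEdges a b) ab in
          subst (λ j → PathEdge (Q j) a b)
                (disjoint (proj₁ (pathEdge⇒∈ e)) (component-path⁻ v∈ a∈)) e)
        (λ e → from (hasEdges a b) (i , e))
    }

-- Path bundles

module Bundle {G : Graph n} {B : Subset n} (𝓕 : RelaxedChronology G B)
              (e : Enumeration B) (x : Fin n) where
  open Graph G
  open RelaxedChronology 𝓕
  open Enumeration e

  private
    C : ℕ → Subset n
    C = Cₓ 𝓕 e x

    term : ℕ → Fin ∣ B ∣ → Fin n
    term = terminal 𝓕 e x

    path : ℕ → Fin ∣ B ∣ → List (Fin n)
    path = bundlePath 𝓕 e x

    r : ℕ
    r = rd x

  -- Otherwise `x` would turn blue in some round before `r`, against `rd-unique`.
  x∉blueBy : ∀ {k} → k < r → x ∉ blueBy k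
  x∉blueBy {k} k<r x∈ =
    let j , j≤k , x∈j = blueBy⇒blueAt k x∈
        j<r = ≤-<-trans j≤k k<r
    in <-irrefl (rd-unique (≤-trans (<⇒≤ j<r) (rd≤K x)) x∈j) j<r

  -- The bound on `k` makes `x` white. For a blue `x`, `component` would still contain `x` itself.
  C-white : ∀ {k y} → k < r → y ∈ C k → y ∉ blueBy k
  C-white {k} k<r y∈ = x∈∁p⇒x∉p (component⊆vertices (G - blueBy k) (x∉p⇒x∈∁p (x∉blueBy k<r)) y∈)

  C-adj : ∀ {k y z} → k < r → y ∈ C k → Adj y z → z ∉ blueBy k → z ∈ C k
  C-adj {k} k<r y∈ yz z∉ =
    component-edge (G - blueBy k) y∈ (yz , x∉p⇒x∈∁p (C-white k<r y∈) , x∉p⇒x∈∁p z∉)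

  -- The white graph only loses vertices, so a walk from `x` in a later one is a walk in every
  -- earlier one.
  C-anti : ∀ {k m y} → k ≤′ m → y ∈ C m → y ∈ C k
  C-anti ≤′-refl           y∈ = y∈
  C-anti (≤′-step {m} k≤m) y∈ = C-anti k≤m
    (from (∈-component (G - blueBy m)) (Star.map weaken (to (∈-component (G - blueBy (suc m))) y∈)))
    where
    earlier : ∀ {a} → a ∈ ∁ (blueBy (suc m)) → a ∈ ∁ (blueBy m)
    earlier a∈ = x∉p⇒x∈∁p (x∈∁p⇒x∉p a∈ ∘ x∈p∪q⁺ ∘ inj₁)

    weaken : ∀ {a b} → Edge (G - blueBy (suc m)) a b → Edge (G - blueBy m) a b
    weaken (ab , a∈ , b∈) = ab , earlier a∈ , earlier b∈

  blueAt-suc : ∀ {k u} → u ∈ blueAt (suc k) ⇔ (∃[ v ] u ∈ F (suc k) v)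
  blueAt-suc {k} = ∈-comprehension (λ u → any? (λ v → u ∈? F (suc k) v))

  -- Forces and the rounds of the bundle

  record Forced (k : ℕ) (u w : Fin n) : Set where
    field
      blue     : u ∈ blueBy k
      white    : w ∉ blueBy k
      adjacent : Adj u w
      only     : w ∈ C k → ∀ {y} → y ∈ C k → Adj u y → y ≡ w

  forced : ∀ {k u w} → k < r → w ∈ F (suc k) u → Forced k u w
  forced {k} {u} {w} k<r w∈F
    with u∈ , D , (c , c∈ , refl) , eq ← valid (<-≤-trans k<r (rd≤K x)) w∈F
    with w∈N , w∈D ← x∈p∩q⁻ (neighbours u) D (subst (w ∈_) (sym eq) (x∈⁅x⁆ w))
    = record
    { blue     = u∈
    ; white    = x∈∁p⇒x∉p (component⊆vertices H c∈ w∈D)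
    ; adjacent = to (∈-comprehension (adj? u)) w∈N
    -- The force is valid for some component `D`; once `w` lies in `C k`, the two components
    -- coincide.
    ; only     = λ w∈C y∈C uy → ∩≡⁅⁆⁻ eq (from (∈-comprehension (adj? u)) uy)
        (component-trans H w∈D (component-trans H (component-sym H w∈C) y∈C))
    }
    where
    H : Subgraph G
    H = G - blueBy k

  -- The outcome of `next`, on which `terminal` and `bundlePath` branch in the same way, so that
  -- later proofs can split both at once.
  data Step (k : ℕ) (i : Fin ∣ B ∣) : Set where
    moves : ∀ w → term (suc k) i ≡ w → path (suc k) i ≡ path k i ∷ʳ w →
            w ∈ F (suc k) (term k i) → w ∈ C k → Step k i
    stays : term (suc k) i ≡ term k i → path (suc k) i ≡ path k i →
            (∀ w → w ∈ F (suc k) (term k i) → w ∉ C k) → Step k i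

  step : ∀ k i → Step k i
  step k i with any? (λ w → (w ∈? F (suc k) (term k i)) ×-dec (w ∈? C k)) in eq
  ... | yes (w , w∈F , w∈C) =
    moves w (cong (maybe′ id (term k i)) next≡) (cong (maybe′ (path k i ∷ʳ_) (path k i)) next≡) w∈F w∈C
    where
    next≡ : next 𝓕 e x k (term k i) ≡ just w
    next≡ rewrite eq = refl
  ... | no none =
    stays (cong (maybe′ id (term k i)) next≡) (cong (maybe′ (path k i ∷ʳ_) (path k i)) next≡)
          (λ w w∈F w∈C → none (w , w∈F , w∈C))
    where
    next≡ : next 𝓕 e x k (term k i) ≡ nothing
    next≡ rewrite eq = refl

  path-∈⁻ : ∀ {k i z} → z List.∈ path (suc k) i →
            z List.∈ path k i ⊎ (z ∈ F (suc k) (term k i) × z ∈ C k)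
  path-∈⁻ {k} {i} z∈ with step k i
  ... | stays _ eq _ = inj₁ (subst (_ List.∈_) eq z∈)
  ... | moves w _ eq w∈F w∈C with ∈-++⁻ (path k i) (subst (_ List.∈_) eq z∈)
  ...   | inj₁ z∈k         = inj₁ z∈k
  ...   | inj₂ (here refl) = inj₂ (w∈F , w∈C)

  path-∷ʳ : ∀ k i → ∃[ xs ] path k i ≡ xs ∷ʳ term k i
  path-∷ʳ zero    i = [] , refl
  path-∷ʳ (suc k) i with step k i
  ... | moves w t≡ p≡ _ _ = path k i , trans p≡ (cong (path k i ∷ʳ_) (sym t≡))
  ... | stays t≡ p≡ _     = let xs , eq = path-∷ʳ k i in
    xs , trans p≡ (trans eq (cong (xs ∷ʳ_) (sym t≡)))

  term∈path : ∀ k i → term k i List.∈ path k i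
  term∈path k i = let xs , eq = path-∷ʳ k i in subst (term k i List.∈_) (sym eq) (∈-++⁺ʳ xs (here refl))

  last-path : ∀ k i → last (path k i) ≡ just (term k i)
  last-path k i = let xs , eq = path-∷ʳ k i in trans (cong last eq) (last-++-∷ xs _ [])

  path-∷ : ∀ k i → ∃[ ys ] path k i ≡ vertex i ∷ ys
  path-∷ zero    i = [] , refl
  path-∷ (suc k) i with path-∷ k i | step k i
  ... | ys , eq | stays _ p≡ _     = ys , trans p≡ eq
  ... | ys , eq | moves w _ p≡ _ _ = ys ∷ʳ w , trans p≡ (cong (_∷ʳ w) eq)

  vertex∈path : ∀ k i → vertex i List.∈ path k i
  vertex∈path k i = subst (_ List.∈_) (sym (proj₂ (path-∷ k i))) (here refl)

  path-blue : ∀ k {i z} → z List.∈ path k i → z ∈ blueBy k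
  path-blue zero    (here refl) = sound _
  path-blue (suc k) z∈ with path-∈⁻ z∈
  ... | inj₁ z∈k       = x∈p∪q⁺ (inj₁ (path-blue k z∈k))
  ... | inj₂ (z∈F , _) = x∈p∪q⁺ {p = blueBy k} (inj₂ (from blueAt-suc (_ , z∈F)))

  -- An appended vertex is white just before its round, while the path so far is blue.
  path-unique : ∀ {k} → k ≤ r → ∀ i → Unique (path k i)
  path-unique {zero}  _   i = All.[] ∷ []
  path-unique {suc k} k<r i with step k i
  ... | stays _ p≡ _       = subst Unique (sym p≡) (path-unique (<⇒≤ k<r) i)
  ... | moves w _ p≡ w∈F _ = subst Unique (sym p≡) (Unique.++⁺ (path-unique (<⇒≤ k<r) i) (All.[] ∷ [])
    λ { (w∈ , here refl) → Forced.white (forced k<r w∈F) (path-blue k w∈) })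

  -- Old vertices are blue and appended ones white. If two paths append the same vertex, `unique`
  -- gives it one forcer, so the paths already shared their end.
  path-disjoint : ∀ {k} → k ≤ r → ∀ {i j z} → z List.∈ path k i → z List.∈ path k j → i ≡ j
  path-disjoint {zero}  _   (here refl) (here eq) = injective eq
  path-disjoint {suc k} k<r {i} {j} z∈i z∈j with path-∈⁻ z∈i | path-∈⁻ z∈j
  ... | inj₁ z∈        | inj₁ z∈′        = path-disjoint (<⇒≤ k<r) z∈ z∈′
  ... | inj₁ z∈        | inj₂ (z∈F , _)  = contradiction (path-blue k z∈) (Forced.white (forced k<r z∈F))
  ... | inj₂ (z∈F , _) | inj₁ z∈         = contradiction (path-blue k z∈) (Forced.white (forced k<r z∈F))
  ... | inj₂ (z∈F , _) | inj₂ (z∈F′ , _) = path-disjoint (<⇒≤ k<r) (term∈path k i)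
    (subst (List._∈ path k j) (sym (unique (<-≤-trans k<r (rd≤K x)) z∈F z∈F′)) (term∈path k j))

  path-linked : ∀ {k} → k ≤ r → ∀ i → Linked Adj (path k i)
  path-linked {zero}  _   i = [-]
  path-linked {suc k} k<r i with step k i
  ... | stays _ p≡ _       = subst (Linked Adj) (sym p≡) (path-linked (<⇒≤ k<r) i)
  ... | moves w _ p≡ w∈F _ = subst (Linked Adj) (sym p≡) (Linked.++⁺ (path-linked (<⇒≤ k<r) i)
    (subst (λ l → Connected Adj l (just w)) (sym (last-path k i))
      (just (Forced.adjacent (forced k<r w∈F)))) [-])

  -- Whatever is appended after round `k` lies in a later component of `x`, hence in `C k`. This
  -- locates the final ends relative to round `k`: a white one must be in `C k`.
  term-later : ∀ {k m} → k ≤′ m → ∀ i → term m i ≡ term k i ⊎ term m i ∈ C k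
  term-later ≤′-refl          i = inj₁ refl
  term-later {k} (≤′-step {m} k≤m) i with step m i
  ... | moves w t≡ _ _ w∈C = inj₂ (subst (_∈ C k) (sym t≡) (C-anti k≤m w∈C))
  ... | stays t≡ _ _       = Sum.map (trans t≡) (subst (_∈ C k) (sym t≡)) (term-later k≤m i)

  -- Once a path has entered `C k`, its end never returns to a vertex that was blue at time `k`; so
  -- an end that has been moved on from is not the final end of its path.
  moved⇒later-white : ∀ {k m i w} → suc k ≤′ m → term (suc k) i ≡ w → w ∈ C k → term m i ∈ C k
  moved⇒later-white {k} {m} {i} k<m t≡ w∈C with term-later k<m i
  ... | inj₁ eq  = subst (_∈ C k) (sym (trans eq t≡)) w∈C
  ... | inj₂ t∈C = C-anti (≤′-step ≤′-refl) t∈C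

  -- A vertex that has used up its only neighbour in C k has none in C (suc k),
  -- and a newly forced vertex is itself the end of its path.
  frontier : ∀ {k} → k < r → ∀ {u y} → u ∈ blueBy k → y ∈ C k → Adj u y → ∃[ i ] term k i ≡ u
  frontier {zero}  _   u∈ _  _  = exhaustive u∈
  frontier {suc k} k+1<r {u} {y} u∈ y∈C uy = case (x∈p∪q⁻ (blueBy k) (blueAt (suc k)) u∈)
    where
    k<r : k < r
    k<r = <⇒≤ k+1<r

    y∈Ck : y ∈ C k
    y∈Ck = C-anti (≤′-step ≤′-refl) y∈C

    case : u ∈ blueBy k ⊎ u ∈ blueAt (suc k) → ∃[ i ] term (suc k) i ≡ u
    case (inj₁ u∈k) with i , refl ← frontier k<r u∈k y∈Ck uy with step k i
    ... | stays t≡ _ _         = i , t≡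
    ... | moves w t≡ _ w∈F w∈C = contradiction
      (subst (_∈ blueBy (suc k)) (trans t≡ (sym (Forced.only (forced k<r w∈F) w∈C y∈Ck uy)))
        (path-blue (suc k) (term∈path (suc k) i)))
      (C-white k+1<r y∈C)
    -- As a white neighbour of `y`, the new vertex `u` lies in `C k`. The induction hypothesis
    -- therefore applies to its forcer `v`.
    case (inj₂ u∈At) with v , u∈F ← to blueAt-suc u∈At = go (frontier k<r blue u∈Ck adjacent)
      where
      open Forced (forced k<r u∈F)

      u∈Ck : u ∈ C k
      u∈Ck = C-adj k<r y∈Ck (symm uy) white

      go : ∃[ i ] term k i ≡ v → ∃[ i ] term (suc k) i ≡ u
      go (i , refl) with step k i
      ... | stays _ _ none        = contradiction u∈Ck (none u u∈F)
      ... | moves w t≡ _ w∈F w∈C = i , trans t≡ (only u∈Ck w∈C (Forced.adjacent (forced k<r w∈F)))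

  -- Uniqueness of the paths

  module Rigid
    (p        : Fin ∣ B ∣ → List (Fin n))
    (starts   : ∀ i → ∃[ s ] p i ≡ vertex i ∷ s × (∀ {z} → z List.∈ s → z ∉ B))
    -- Only the set of ends is prescribed: `p i` may a priori stop at the end of another bundle
    -- path.
    (ends     : ∀ i {b} → last (p i) ≡ just b → ∃[ j ] term r j ≡ b)
    (simple   : ∀ i → Unique (p i))
    (disjoint : ∀ {i j z} → z List.∈ p i → z List.∈ p j → i ≡ j)
    (linked   : ∀ i → Linked Adj (p i))
    where

    rest⊆C : ∀ {k} → k < r → ∀ i {s} → p i ≡ path k i ++ s → (∀ {z} → z List.∈ s → z ∉ blueBy k) →
             ∀ {z} → z List.∈ s → z ∈ C k
    rest⊆C {k} k<r i {y ∷ s} p≡ white z∈ = go (last-∷ y s)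
      where
      H : Subgraph G
      H = G - blueBy k

      inH : Linked (Edge H) (y ∷ s)
      inH = consecutive⇒linked λ ab →
        linked⇒consecutive (linked-++⁻ʳ (path k i) (subst (Linked Adj) p≡ (linked i))) ab
        , x∉p⇒x∈∁p (white (proj₁ (consecutive⇒∈ ab))) , x∉p⇒x∈∁p (white (proj₂ (consecutive⇒∈ ab)))

      reach : ∀ {z} → z List.∈ y ∷ s → z ∈ component H y
      reach = from (∈-component H) ∘ linked⇒star inH

      go : ∃[ b ] last (y ∷ s) ≡ just b × b List.∈ y ∷ s → _ ∈ C k
      go (b , last≡ , b∈)
        -- The last vertex is some `term r j`. Being white at time `k`, it differs from `term k j`,
        -- so `term-later` puts it in `C k`, and the whole connected rest follows it.
        with j , refl ← ends i (trans (cong last p≡) (trans (last-++-∷ (path k i) y s) last≡))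
        with term-later (≤⇒≤′ (<⇒≤ k<r)) j
      ... | inj₁ eq  = contradiction
        (subst (_∈ blueBy k) (sym eq) (path-blue k (term∈path k j))) (white b∈)
      ... | inj₂ b∈C =
        component-trans H b∈C (component-trans H (component-sym H (reach b∈)) (reach z∈))

    extends : ∀ {k} → k < r → ∀ i {s} → p i ≡ path k i ++ s → (∀ {z} → z List.∈ s → z ∉ blueBy k) →
              ∃[ s′ ] p i ≡ path (suc k) i ++ s′ × (∀ {z} → z List.∈ s′ → z List.∈ s)
    extends {k} k<r i {s} p≡ white with step k i
    ... | stays _ q≡ _ = s , trans p≡ (cong (_++ s) (sym q≡)) , λ z∈ → z∈
    -- Here `p i` would stop at `term k i`. That vertex is blue at time `k`, so as a final end it
    -- could only be the unmoved end of a path through it; this path is the one of `i`, which has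
    -- moved.
    extends {k} k<r i {[]} p≡ white | moves w t≡ q≡ w∈F w∈C =
      contradiction (ends i (trans (cong last (trans p≡ (++-identityʳ _))) (last-path k i))) not-end
      where
      not-end : ¬ (∃[ j ] term r j ≡ term k i)
      not-end (j , eq) with term-later (≤⇒≤′ (<⇒≤ k<r)) j
      ... | inj₂ t∈C = C-white k<r (subst (_∈ C k) eq t∈C) (path-blue k (term∈path k i))
      ... | inj₁ same with path-disjoint (<⇒≤ k<r) (term∈path k i)
                             (subst (List._∈ path k j) (trans (sym same) eq) (term∈path k j))
      ...   | refl = C-white k<r (moved⇒later-white (≤⇒≤′ k<r) t≡ w∈C)
                       (subst (_∈ blueBy k) (sym eq) (path-blue k (term∈path k i)))
    extends {k} k<r i {y ∷ s} p≡ white | moves w t≡ q≡ w∈F w∈C with path-∷ʳ k i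
    ... | xs , path≡
      -- The next vertex `y` of `p i` is in `C k` by `rest⊆C` and adjacent to `term k i`, so it is
      -- the forced vertex `w`.
      with refl ← Forced.only (forced k<r w∈F) w∈C (rest⊆C k<r i p≡ white (here refl))
                    (linked⇒consecutive (linked i)
                      (xs , s , trans p≡ (trans (cong (_++ y ∷ s) path≡) (∷ʳ-++ xs _ (y ∷ s)))))
      = s , trans p≡ (trans (sym (∷ʳ-++ (path k i) y s)) (cong (_++ s) (sym q≡))) , there

    -- The induction treats all paths simultaneously: that the rest of one path stays white depends
    -- on the initial segments of the others.
    prefix : ∀ k → k ≤ r → ∀ i → ∃[ s ] p i ≡ path k i ++ s × (∀ {z} → z List.∈ s → z ∉ blueBy k)
    prefix zero    _   i = starts i
    prefix (suc k) k<r i = let s , p≡ , s⊆ = longer i in s , p≡ , white p≡ s⊆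
      where
      longer : ∀ i → ∃[ s′ ] p i ≡ path (suc k) i ++ s′ ×
                     (∀ {z} → z List.∈ s′ → z List.∈ proj₁ (prefix k (<⇒≤ k<r) i))
      longer i = let s , p≡ , s-white = prefix k (<⇒≤ k<r) i in extends k<r i p≡ s-white

      white : ∀ {s′} → p i ≡ path (suc k) i ++ s′ →
              (∀ {z} → z List.∈ s′ → z List.∈ proj₁ (prefix k (<⇒≤ k<r) i)) →
              ∀ {z} → z List.∈ s′ → z ∉ blueBy (suc k)
      white {s′} p≡ s⊆ {z} z∈ z-blue with x∈p∪q⁻ (blueBy k) (blueAt (suc k)) z-blue
      ... | inj₁ z∈k = proj₂ (proj₂ (prefix k (<⇒≤ k<r) i)) (s⊆ z∈) z∈k
      -- A vertex of the rest forced in round `suc k` lies in `C k`, so `frontier` makes its forcer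
      -- the end of some bundle path `j`.
      ... | inj₂ z∈At with v , z∈F ← to blueAt-suc z∈At = go (frontier k<r blue z∈C adjacent)
        where
        open Forced (forced k<r z∈F) hiding (white)

        z∈C : z ∈ C k
        z∈C = let s , p≡ , s-white = prefix k (<⇒≤ k<r) i in rest⊆C k<r i p≡ s-white (s⊆ z∈)

        go : ¬ (∃[ j ] term k j ≡ v)
        go (j , refl) with step k j
        ... | stays _ _ none       = none z z∈F z∈C
        -- Path `j` was extended by `z`, so `z` lies on both `p j` and `p i`. Hence `i ≡ j`, and `z`
        -- would occur twice on `p i`: in the initial segment and in the rest.
        ... | moves w t≡ _ w∈F w∈C = Unique-++⇒disjoint (path (suc k) i)
          (subst Unique p≡ (simple i)) (subst (λ j → z List.∈ path (suc k) j) (sym i≡j) z∈path) z∈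
          where
          z∈path : z List.∈ path (suc k) j
          z∈path = subst (List._∈ path (suc k) j)
            (trans t≡ (only z∈C w∈C (Forced.adjacent (forced k<r w∈F)))) (term∈path (suc k) j)

          i≡j : i ≡ j
          i≡j = disjoint (subst (z List.∈_) (sym p≡) (∈-++⁺ʳ (path (suc k) i) z∈))
            (let _ , p≡ , _ = longer j in subst (z List.∈_) (sym p≡) (∈-++⁺ˡ z∈path))

    p≡pathBundle : ∀ i → p i ≡ path r i
    p≡pathBundle i with prefix r ≤-refl i
    ... | []    , p≡ , _     = trans p≡ (++-identityʳ _)
    ... | y ∷ s , p≡ , white with last-∷ y s
    ... | b , last≡ , b∈
      -- A nonempty rest would end at some `term r j`, which is already blue at time `r`.
      with j , refl ← ends i (trans (cong last p≡) (trans (last-++-∷ (path r i) y s) last≡))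
      = contradiction (path-blue r (term∈path r j)) (white b∈)

  -- The bundle as a linkage from its starts to its ends

  bundle : Subgraph G
  bundle = unionOfPaths (path r) (path-linked ≤-refl)

  ∈-bundle : ∀ {v} → v ∈ vertices bundle ⇔ (∃[ i ] v List.∈ path r i)
  ∈-bundle = ∈-comprehension (onSome? (path r))

  bundle-isUnion : IsDisjointUnionOfPaths bundle (pathBundle 𝓕 e x)
  bundle-isUnion = record
    { simple      = path-unique ≤-refl
    ; disjoint    = path-disjoint ≤-refl
    ; hasVertices = λ v → ∈-bundle
    ; hasEdges    = λ a b → mk⇔ id id
    }

  terminals : Subset n
  terminals = comprehension (λ v → any? λ i → term r i ≟ v)

  ∈-terminals : ∀ {v} → v ∈ terminals ⇔ (∃[ i ] term r i ≡ v)
  ∈-terminals = ∈-comprehension (λ v → any? λ i → term r i ≟ v)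

  bundle-component : ∀ {D} → IsComponent bundle D → ∃[ i ] IsPathOn bundle D (path r i)
  bundle-component (v , v∈ , refl) =
    let i , v∈i = to ∈-bundle v∈ in i , component-isPathOn bundle-isUnion v∈i

  bundle-isLinkageBetween : IsLinkageBetween B terminals bundle
  bundle-isLinkageBetween = record
    { linkage = λ D → let i , onD = bundle-component D in path r i , onD
    ; α⊆      = λ b∈ → let i , eq = exhaustive b∈ in
        from ∈-bundle (i , subst (List._∈ path r i) eq (vertex∈path r i))
    ; β⊆      = λ t∈ → let i , eq = to ∈-terminals t∈ in
        from ∈-bundle (i , subst (List._∈ path r i) eq (term∈path r i))
    ; ends    = λ D → let i , onD = bundle-component D in path r i , onD , meets onD
    }
    where
    meets : ∀ {D i} → IsPathOn bundle D (path r i) → MeetsAtEnds {G = G} B terminals D (path r i)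
    meets {D} {i} onD =
      vertex i , term r i , cong head (proj₂ (path-∷ r i)) , last-path r i ,
      -- Every other vertex of `B` starts another, disjoint bundle path; the same argument handles
      -- the ends.
      ∩≡⁅⁆ (sound i) (on (vertex∈path r i)) (λ b∈ b∈D →
        let j , eq = exhaustive b∈
            j≡i    = path-disjoint ≤-refl (subst (List._∈ path r j) eq (vertex∈path r j)) (off b∈D)
        in trans (sym eq) (cong vertex j≡i)) ,
      ∩≡⁅⁆ (from ∈-terminals (i , refl)) (on (term∈path r i)) (λ b∈ b∈D →
        let j , eq = to ∈-terminals b∈
            j≡i    = path-disjoint ≤-refl (subst (List._∈ path r j) eq (term∈path r j)) (off b∈D)
        in trans (sym eq) (cong (term r) j≡i))
      where
      on : ∀ {v} → v List.∈ path r i → v ∈ D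
      on = from (IsPathOn.hasVertices onD _)

      off : ∀ {v} → v ∈ D → v List.∈ path r i
      off = to (IsPathOn.hasVertices onD _)

  -- Comparison with an arbitrary linkage

  module _ {P : Subgraph G} (between : IsLinkageBetween B terminals P) where
    open IsLinkageBetween between

    private
      -- Each component of `P` meets `B` in exactly one vertex, so the enumeration of `B` also
      -- indexes the components.
      D : Fin ∣ B ∣ → Subset n
      D i = component P (vertex i)

      pathOn : ∀ i → ∃[ p ] IsPathOn P (D i) p × MeetsAtEnds {G = G} B terminals (D i) p
      pathOn i = ends (vertex i , α⊆ (sound i) , refl)

      p : Fin ∣ B ∣ → List (Fin n)
      p i = proj₁ (pathOn i)

      open module OnD i = IsPathOn (proj₁ (proj₂ (pathOn i)))

    D∩B : ∀ {i b} → b ∈ B → b ∈ D i → b ≡ vertex i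
    D∩B {i} b∈B b∈D with a , _ , _ , _ , α∩ , _ ← proj₂ (proj₂ (pathOn i)) =
      trans (∩≡⁅⁆⁻ α∩ b∈B b∈D) (sym (∩≡⁅⁆⁻ α∩ (sound i) (component-refl P (vertex i))))

    p-starts : ∀ i → ∃[ s ] p i ≡ vertex i ∷ s × (∀ {z} → z List.∈ s → z ∉ B)
    -- The facts about `p i` are abstracted together with it so that they follow the case split; its
    -- having a head rules out the empty list.
    p-starts i with p i | D∩B {i} | simple i | hasVertices i | proj₂ (proj₂ (pathOn i))
    ... | y ∷ s | only | y∉s ∷ _ | verts | _ , _ , refl , _ , α∩ , _
      with refl ← ∩≡⁅⁆⁻ α∩ (sound i) (component-refl P (vertex i))
      = s , refl , λ z∈s z∈B →
          All.lookup y∉s z∈s (sym (only z∈B (from (verts _) (there z∈s))))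

    p-ends : ∀ i {b} → last (p i) ≡ just b → ∃[ j ] term r j ≡ b
    p-ends i last≡ with _ , b , _ , last≡′ , _ , β∩ ← proj₂ (proj₂ (pathOn i))
      with refl ← just-injective (trans (sym last≡) last≡′)
      = to ∈-terminals (proj₁ (x∈p∩q⁻ terminals (D i) (subst (b ∈_) (sym β∩) (x∈⁅x⁆ b))))

    -- A common vertex would put both starts in one component, which has room for only one vertex of
    -- `B`.
    p-disjoint : ∀ {i j z} → z List.∈ p i → z List.∈ p j → i ≡ j
    p-disjoint {i} {j} z∈i z∈j = injective (sym (D∩B (sound j)
      (component-trans P (from (hasVertices i _) z∈i)
        (component-sym P (from (hasVertices j _) z∈j)))))

    p-linked : ∀ i → Linked Adj (p i)
    p-linked i = consecutive⇒linked λ ab →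
      let a∈ , b∈ = consecutive⇒∈ ab in
      edge⇒adj P (Equivalence.from
        (hasEdges i (from (hasVertices i _) a∈) (from (hasVertices i _) b∈))
        (inj₁ ab))

    p≡path : ∀ i → p i ≡ path r i
    p≡path = Rigid.p≡pathBundle p p-starts p-ends simple p-disjoint p-linked

    -- The component of `v` contains a vertex of `B`, so the paths indexed by `B` exhaust `P`.
    inSomeD : ∀ {v} → v ∈ vertices P → ∃[ i ] v ∈ D i
    inSomeD {v} v∈ with _ , _ , a , _ , _ , _ , α∩ , _ ← ends (v , v∈ , refl)
      with a∈B , a∈D ← x∈p∩q⁻ B (component P v) (subst (a ∈_) (sym α∩) (x∈⁅x⁆ a))
      with i , refl ← exhaustive a∈B
      = i , component-sym P a∈D

    D⇔path : ∀ {i v} → v ∈ D i ⇔ v List.∈ path r i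
    D⇔path {i} {v} = subst (λ q → v ∈ D i ⇔ v List.∈ q) (p≡path i) (hasVertices i v)

    edges : ∀ {i a b} → a ∈ D i → b ∈ D i → Edge P a b ⇔ PathEdge (path r i) a b
    edges {i} {a} {b} a∈ b∈ = subst (λ q → Edge P a b ⇔ PathEdge q a b) (p≡path i) (hasEdges i a∈ b∈)

    ≈bundle : P ≈ bundle
    ≈bundle =
      ⊆-antisym
        (λ v∈ → let i , v∈D = inSomeD v∈ in from ∈-bundle (i , to D⇔path v∈D))
        (λ v∈ → let i , v∈i = to ∈-bundle v∈ in
          component⊆vertices P (α⊆ (sound i)) (from D⇔path v∈i)) ,
      λ a b → mk⇔
        (λ ab → let i , a∈D = inSomeD (edge-start P ab) in
          i , to (edges a∈D (component-edge P a∈D ab)) ab)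
        (λ (i , ab) → let a∈ , b∈ = pathEdge⇒∈ ab in
          from (edges (from D⇔path a∈) (from D⇔path b∈)) ab)

theoremB4 : ∀ {n : ℕ} (G : Graph n) (B : Subset n) → IsPSDForcingSet G B →
    (𝓕 : RelaxedChronology G B) (e : Enumeration B) (x : Fin n) →
    Σ[ L ∈ Subgraph G ] (IsDisjointUnionOfPaths L (pathBundle 𝓕 e x) × IsRigidLinkage L)
theoremB4 G B _ 𝓕 e x =
  bundle , bundle-isUnion , B , terminals , bundle-isLinkageBetween , λ P between → ≈bundle between
  where open Bundle 𝓕 e x
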